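{- Let $p\ge5$ be an odd prime and put $g:=\left\lfloor\frac{p-1}{4}\right\rfloor$. If $n$ is a positive integer with $n\le (p-1)/2$ and $$n=ag+r,\qquad 0\le r<g,$$ with $a,r$ integers, then $$G(g,n)\le p-\left\lceil \frac{p+\frac{g a(a-1)}2+ra}{n}\right\rceil.$$ The same bound is valid for every larger target multiplicity: for every integer $g'\ge g$, $G(g',n)$ is at most the same right-hand side (computed with the original $g,a,r$).
   Context: A finite set $\mathcal{G}\subset\mathbb{Z}$ is a $g$-Golomb ruler if for every positive integer $d$ the number of pairs $(a,c)\in \mathcal{G}^2$ with $c-a=d$ is at most $g$. $G(g,n)$ denotes the minimum possible diameter (largest element minus smallest element) of a $g$-Golomb ruler with exactly $n$ elements (marks). -}

module Defs where

open import Data.Integer using (ℤ; 0ℤ; _-_; _≤_; _<_; _≟_)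
open import Data.Integer.Properties using (≤-totalOrder)
open import Data.List using (List; []; _∷_; length; filter; cartesianProduct)
open import Data.List.Extrema ≤-totalOrder using (max; min)
open import Data.List.Relation.Unary.Unique.Propositional using (Unique)
open import Data.Nat as ℕ using (ℕ)
open import Data.Product using (_×_; _,_; ∃-syntax)
open import Relation.Binary.PropositionalEquality using (_≡_)

-- Finite subsets of ℤ are duplicate-free lists (see `Unique` below), so that
-- `length` is cardinality, for the set itself and for its square.

differenceCount : List ℤ → ℤ → ℕ
differenceCount G d =
  length (filter (λ (a , c) → (c - a) ≟ d) (cartesianProduct G G))

IsGolombRuler : ℕ → List ℤ → Set
IsGolombRuler g G = Unique G × (∀ d → 0ℤ < d → differenceCount G d ℕ.≤ g)

-- The value at [] is a convention; rulers with n ≥ 1 marks never use it.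
diameter : List ℤ → ℤ
diameter []       = 0ℤ
diameter (x ∷ xs) = max x xs - min x xs

-- The graph of G: `IsMinDiameter g n m` says that G(g,n) is defined and equals
-- m.  A relation is used because no ruler exists when g = 0 and n ≥ 2.
IsMinDiameter : ℕ → ℕ → ℤ → Set
IsMinDiameter g n m =
  (∃[ G ] IsGolombRuler g G × length G ≡ n × diameter G ≡ m) ×
  (∀ G → IsGolombRuler g G → length G ≡ n → m ≤ diameter G)

{-# OPTIONS --safe #-}

-- The squares 1², …, n² are distinct mod p. Every pair of them with difference d ≢ 0 gives four
-- pairs of roots (±u, ±v), and (v - u)(v + u) = d shows that v - u determines the pair of roots;
-- hence there are at most g = ⌊(p-1)/4⌋ such pairs. Cutting the circle ℤ/p just before a point v
-- unrolls the set into a g-Golomb ruler, whose diameter ecc v is p minus the gap preceding v.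
-- The n gaps sum to p and each value is taken at most g times, so the deficits from the largest
-- gap sum to at least g(0 + 1 + … + (a-1)) + ra, which bounds the largest gap from below.
-- The minimum G(g′,n) exists because up to translation the rulers of bounded diameter can be
-- searched.

module Submission where

open import Defs
open import Data.Integer as ℤ using (ℤ; +_; 0ℤ; 1ℤ; _%ℕ_; _◃_)
open import Data.Nat as ℕ using (ℕ; zero; suc; NonZero; _∸_; z≤n; s≤s)
open import Data.Nat.Divisibility using (_∣_)
open import Data.Nat.Primality using (Prime; euclidsLemma)
open import Data.Product using (_×_; _,_; ∃-syntax; proj₁; proj₂)
open import Data.Rational as ℚ using (ℚ; ceiling; floor; _/_; ↥_; ↧_; ↧ₙ_)
open import Relation.Binary.PropositionalEquality using (_≡_; _≢_; refl; sym; trans; cong; cong₂; subst; subst₂; setoid; module ≡-Reasoning)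
open import Relation.Nullary using (¬_; Dec; yes; no; contradiction)

import Algebra.Properties.AbelianGroup as AbelianGroup
open import Data.Fin as Fin using (Fin; toℕ)
import Data.Fin.Properties as Fin
import Data.Integer.DivMod as ℤ
open import Data.Integer.Divisibility.Signed using (divides; ∣⇒∣ᵤ; ∣ᵤ⇒∣; ∣m∣n⇒∣m+n; ∣m∣n⇒∣m-n; ∣m⇒∣m*n; ∣m⇒∣-m) renaming (_∣_ to _∣ℤ_; _∣?_ to _∣ℤ?_)
import Data.Integer.Properties as ℤ
open import Data.Integer.Tactic.RingSolver using (solve-∀)
import Data.Nat.Properties as ℕ
open import Data.List using (List; []; _∷_; _++_; length; lookup; map; filter; concatMap; upTo; applyUpTo; allFin; cartesianProduct; cartesianProductWith)
open import Data.List.Extrema ℕ.≤-totalOrder using (argmin; argmax; f[argmin]≤f[xs]; f[xs]≤f[argmax])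
open import Data.List.Extrema ℤ.≤-totalOrder using (max; min; min≤⊤; min≤xs; v≤min⁺; ⊥≤max; xs≤max; max≤v⁺)
open import Data.List.Membership.DecPropositional ℤ._≟_ using (_∈?_)
open import Data.List.Membership.Propositional using (_∈_; lose; find)
open import Data.List.Membership.Propositional.Properties using (∈-lookup; ∈-allFin; ∈-upTo⁺; ∈-upTo⁻; ∈-applyUpTo⁺; ∈-map⁺; ∈-map⁻; ∈-filter⁻; ∈-cartesianProduct⁻; ∈-cartesianProductWith⁺)
open import Data.List.Membership.Setoid.Properties using (index-injective)
open import Data.List.Properties using (length-++; length-map; length-applyUpTo; length-upTo; length-tabulate; map-++; map-∘; filter-none; filter-accept; filter-reject; filter-≐)
open import Data.List.Relation.Unary.All as All using (All; []; _∷_)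
import Data.List.Relation.Unary.All.Properties as All
open import Data.List.Relation.Unary.AllPairs using ([]; _∷_)
open import Data.List.Relation.Unary.Any as Any using (any?; index; here)
import Data.List.Relation.Unary.Any.Properties as Any
open import Data.List.Relation.Unary.Unique.DecPropositional ℤ._≟_ using (unique?)
open import Data.List.Relation.Unary.Unique.Propositional using (Unique)
open import Data.List.Relation.Unary.Unique.Propositional.Properties using (cartesianProduct⁺; filter⁺; map⁺; allFin⁺; upTo⁺)
import Data.Nat.Divisibility as ℕ
import Data.Nat.DivMod as ℕ
open import Data.Nat.ListAction using (sum)
import Data.Nat.Tactic.RingSolver as ℕ using (solve-∀)
open import Data.Product.Properties using (,-injectiveˡ)
import Data.Rational.Properties as ℚ
open import Data.Rational.Unnormalised as ℚᵘ using (mkℚᵘ; *≤*)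
import Data.Rational.Unnormalised.Properties as ℚᵘ
open import Data.Sign as Sign using (Sign)
open import Data.Sum as Sum using (_⊎_; inj₁; inj₂; [_,_]′)
open import Data.Unit using (tt)
open import Function using (_∘_; const; id)
open import Level using (0ℓ)
open import Relation.Nullary.Decidable using (map′; _×-dec_; _→-dec_)
open import Relation.Unary using (Pred; Decidable)

private variable
  A B : Set

-- Comparing lengths of lists

lookup-injective : {xs : List A} → Unique xs → ∀ {i j} → lookup xs i ≡ lookup xs j → i ≡ j
lookup-injective (_ ∷ _)   {Fin.zero}  {Fin.zero}  _  = refl
lookup-injective (x∉ ∷ _)  {Fin.zero}  {Fin.suc j} eq = contradiction eq (All.lookup x∉ (∈-lookup j))
lookup-injective (x∉ ∷ _)  {Fin.suc i} {Fin.zero}  eq = contradiction (sym eq) (All.lookup x∉ (∈-lookup i))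
lookup-injective (_ ∷ !xs) {Fin.suc i} {Fin.suc j} eq = cong Fin.suc (lookup-injective !xs eq)

-- Each membership proof selects a position of `ys`. Equal positions force `f x ≡ f y`, so the
-- positions of `xs` inject into those of `ys` and the pigeonhole principle for `Fin` applies.
length-injection : {xs : List A} {ys : List B} (f : A → B) → Unique xs →
  (∀ {x} → x ∈ xs → f x ∈ ys) →
  (∀ {x y} → x ∈ xs → y ∈ xs → f x ≡ f y → x ≡ y) →
  length xs ℕ.≤ length ys
length-injection f !xs f∈ f-inj = Fin.injective⇒≤ λ {i} {j} eq →
  lookup-injective !xs (f-inj (∈-lookup i) (∈-lookup j)
    (index-injective (setoid _) (f∈ (∈-lookup i)) (f∈ (∈-lookup j)) eq))

length-cartesianProduct : (xs : List A) (ys : List B) →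
  length (cartesianProduct xs ys) ≡ length xs ℕ.* length ys
length-cartesianProduct []       ys = refl
length-cartesianProduct (x ∷ xs) ys =
  trans (length-++ (map (x ,_) ys))
        (cong₂ ℕ._+_ (length-map _ ys) (length-cartesianProduct xs ys))

-- Residues

∣∧∣i∣<⇒≡0 : ∀ {p i} → + p ∣ℤ i → ℤ.∣ i ∣ ℕ.< p → i ≡ 0ℤ
∣∧∣i∣<⇒≡0 {p} {i} p∣i i<p with ℤ.∣ i ∣ in eq
... | zero  = ℤ.∣i∣≡0⇒i≡0 eq
... | suc k = contradiction (subst (p ℕ.∣_) eq (∣⇒∣ᵤ p∣i)) (ℕ.>⇒∤ i<p)

∣i-j∣∧<⇒≡ : ∀ {p i j} → + p ∣ℤ i ℤ.- j → ℤ.∣ i ∣ ℕ.+ ℤ.∣ j ∣ ℕ.< p → i ≡ j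
∣i-j∣∧<⇒≡ {i = i} {j} p∣ lt =
  ℤ.i-j≡0⇒i≡j i j (∣∧∣i∣<⇒≡0 p∣ (ℕ.≤-<-trans (ℤ.∣i-j∣≤∣i∣+∣j∣ i j) lt))

∣+m-+n∣< : ∀ {m n p} → m ℕ.< p → n ℕ.< p → ℤ.∣ + m ℤ.- + n ∣ ℕ.< p
∣+m-+n∣< {m} {n} m<p n<p rewrite ℤ.m-n≡m⊖n m n =
  ℕ.≤-<-trans (ℤ.∣m⊝n∣≤m⊔n m n) (ℕ.⊔-lub m<p n<p)

∣+m-+n⇒m≡n : ∀ {m n p} → m ℕ.< p → n ℕ.< p → + p ∣ℤ + m ℤ.- + n → m ≡ n
∣+m-+n⇒m≡n {m} {n} m<p n<p p∣ =
  ℤ.+-injective (ℤ.i-j≡0⇒i≡j (+ m) (+ n) (∣∧∣i∣<⇒≡0 p∣ (∣+m-+n∣< m<p n<p)))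

n∣i%ℕn-i : ∀ i n .{{_ : NonZero n}} → + n ∣ℤ + (i %ℕ n) ℤ.- i
n∣i%ℕn-i i n = divides (ℤ.- q) (begin
  + r ℤ.- i                       ≡⟨ cong (λ z → + r ℤ.- z) (ℤ.a≡a%ℕn+[a/ℕn]*n i n) ⟩
  + r ℤ.- (+ r ℤ.+ q ℤ.* + n)     ≡⟨ identity (+ r) q (+ n) ⟩
  ℤ.- q ℤ.* + n                   ∎)
  where
  open ≡-Reasoning
  r = i %ℕ n
  q = i ℤ./ℕ n
  identity : ∀ r q n → r ℤ.- (r ℤ.+ q ℤ.* n) ≡ ℤ.- q ℤ.* n
  identity = solve-∀

%ℕ≡0⇒∣ : ∀ i n .{{_ : NonZero n}} → i %ℕ n ≡ 0 → + n ∣ℤ i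
%ℕ≡0⇒∣ i n eq = subst (+ n ∣ℤ_) (identity i) (∣m⇒∣-m (subst (λ r → + n ∣ℤ + r ℤ.- i) eq (n∣i%ℕn-i i n)))
  where
  identity : ∀ i → ℤ.- (+ 0 ℤ.- i) ≡ i
  identity = solve-∀

%ℕ≡⇒∣ : ∀ i j n .{{_ : NonZero n}} → i %ℕ n ≡ j %ℕ n → + n ∣ℤ i ℤ.- j
%ℕ≡⇒∣ i j n eq = subst (+ n ∣ℤ_) (identity (+ (j %ℕ n)) i j)
  (∣m∣n⇒∣m-n (n∣i%ℕn-i j n) (subst (λ r → + n ∣ℤ + r ℤ.- i) eq (n∣i%ℕn-i i n)))
  where
  identity : ∀ r i j → r ℤ.- j ℤ.- (r ℤ.- i) ≡ i ℤ.- j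
  identity = solve-∀

∈-[1‥p-1] : ∀ {k p} → k ≢ 0 → k ℕ.< p → k ∈ applyUpTo suc (p ∸ 1)
∈-[1‥p-1] {zero}  k≢0 _   = contradiction refl k≢0
∈-[1‥p-1] {suc k} _   k<p = ∈-applyUpTo⁺ suc (ℕ.∸-monoˡ-≤ 1 k<p)

-- Modulo `p`, `d` is the product of `y - x` and `y + x`. This keeps the difference of two roots out
-- of the class 0, which leaves it `p - 1` residues.
∤y-x : ∀ {p d x y} → ¬ + p ∣ℤ d → + p ∣ℤ y ℤ.* y ℤ.- x ℤ.* x ℤ.- d → ¬ + p ∣ℤ y ℤ.- x
∤y-x {p} {d} {x} {y} p∤d p∣diff p∣y-x =
  p∤d (subst (+ p ∣ℤ_) (identity x y d) (∣m∣n⇒∣m-n (∣m⇒∣m*n (y ℤ.+ x) p∣y-x) p∣diff))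
  where
  identity : ∀ x y d → (y ℤ.- x) ℤ.* (y ℤ.+ x) ℤ.- (y ℤ.* y ℤ.- x ℤ.* x ℤ.- d) ≡ d
  identity = solve-∀

module _ {p : ℕ} (p-prime : Prime p) where

  prime∣i*j : ∀ i j → + p ∣ℤ i ℤ.* j → + p ∣ℤ i ⊎ + p ∣ℤ j
  prime∣i*j i j p∣ij =
    [ inj₁ ∘ ∣ᵤ⇒∣ , inj₂ ∘ ∣ᵤ⇒∣ ]′
      (euclidsLemma ℤ.∣ i ∣ ℤ.∣ j ∣ p-prime (subst (p ℕ.∣_) (ℤ.abs-* i j) (∣⇒∣ᵤ p∣ij)))

  -- If y² - x² = d, then y - x is a unit mod p that determines y + x = d / (y - x), and with
  -- it x and y.
  root-difference-determines : ∀ {d x y x′ y′} → 2 ℕ.< p → ¬ + p ∣ℤ d →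
    + p ∣ℤ y ℤ.* y ℤ.- x ℤ.* x ℤ.- d → + p ∣ℤ y′ ℤ.* y′ ℤ.- x′ ℤ.* x′ ℤ.- d →
    + p ∣ℤ (y ℤ.- x) ℤ.- (y′ ℤ.- x′) →
    + p ∣ℤ x ℤ.- x′ × + p ∣ℤ y ℤ.- y′
  root-difference-determines {d} {x} {y} {x′} {y′} 2<p p∤d p∣₁ p∣₂ p∣Δt = p∣x , p∣y
    where
    t = y ℤ.- x
    Δt = t ℤ.- (y′ ℤ.- x′)
    Δs = (y ℤ.+ x) ℤ.- (y′ ℤ.+ x′)

    identity₁ : ∀ x y x′ y′ d →
      (y ℤ.* y ℤ.- x ℤ.* x ℤ.- d) ℤ.- (y′ ℤ.* y′ ℤ.- x′ ℤ.* x′ ℤ.- d)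
        ℤ.- ((y ℤ.- x) ℤ.- (y′ ℤ.- x′)) ℤ.* (y′ ℤ.+ x′)
      ≡ (y ℤ.- x) ℤ.* ((y ℤ.+ x) ℤ.- (y′ ℤ.+ x′))
    identity₁ = solve-∀

    identity₂ : ∀ x y x′ y′ →
      ((y ℤ.+ x) ℤ.- (y′ ℤ.+ x′)) ℤ.- ((y ℤ.- x) ℤ.- (y′ ℤ.- x′)) ≡ + 2 ℤ.* (x ℤ.- x′)
    identity₂ = solve-∀

    identity₃ : ∀ x y x′ y′ → ((y ℤ.- x) ℤ.- (y′ ℤ.- x′)) ℤ.+ (x ℤ.- x′) ≡ y ℤ.- y′
    identity₃ = solve-∀

    p∣Δs : + p ∣ℤ Δs
    p∣Δs = [ (λ p∣t → contradiction p∣t (∤y-x {x = x} {y} p∤d p∣₁)) , id ]′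
      (prime∣i*j t Δs (subst (+ p ∣ℤ_) (identity₁ x y x′ y′ d)
        (∣m∣n⇒∣m-n (∣m∣n⇒∣m-n p∣₁ p∣₂) (∣m⇒∣m*n (y′ ℤ.+ x′) p∣Δt))))

    p∣x : + p ∣ℤ x ℤ.- x′
    -- As `2 < p`, the factor 2 cancels modulo the prime `p`.
    p∣x = [ (λ p∣2 → contradiction (∣⇒∣ᵤ p∣2) (ℕ.>⇒∤ 2<p)) , id ]′
      (prime∣i*j (+ 2) (x ℤ.- x′) (subst (+ p ∣ℤ_) (identity₂ x y x′ y′) (∣m∣n⇒∣m-n p∣Δs p∣Δt)))

    p∣y : + p ∣ℤ y ℤ.- y′
    p∣y = subst (+ p ∣ℤ_) (identity₃ x y x′ y′) (∣m∣n⇒∣m+n p∣Δt p∣x)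

-- Differences of squares

-- Counting from 1 avoids 0, so a root differs from its negative and its sign can be recovered.
root : ∀ {n} → Fin n → ℕ
root u = suc (toℕ u)

square : ∀ {n} → Fin n → ℤ
square u = + root u ℤ.* + root u

◃-square : ∀ ε m → (ε ◃ m) ℤ.* (ε ◃ m) ≡ + m ℤ.* + m
◃-square Sign.+ m rewrite ℤ.+◃n≡+n m = refl
◃-square Sign.- m rewrite ℤ.-◃n≡-n m = identity (+ m)
  where
  identity : ∀ m → (ℤ.- m) ℤ.* (ℤ.- m) ≡ m ℤ.* m
  identity = solve-∀

◃-root-injective : ∀ {n} {ε η : Sign} {u v : Fin n} →
  ε ◃ root u ≡ η ◃ root v → ε ≡ η × u ≡ v
◃-root-injective {ε = ε} {η} {u} {v} eq =
  trans (sym (ℤ.sign-◃ ε (root u))) (trans (cong ℤ.sign eq) (ℤ.sign-◃ η (root v))) ,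
  Fin.toℕ-injective (ℕ.suc-injective
    (trans (sym (ℤ.abs-◃ ε (root u))) (trans (cong ℤ.∣_∣ eq) (ℤ.abs-◃ η (root v)))))

module _ {p n : ℕ} (p-prime : Prime p) (2<p : 2 ℕ.< p) (n≤ : n ℕ.≤ (p ∸ 1) ℕ./ 2) where

  n+n<p : n ℕ.+ n ℕ.< p
  n+n<p = begin-strict
    n ℕ.+ n            ≡⟨ cong (n ℕ.+_) (ℕ.+-identityʳ n) ⟨
    2 ℕ.* n            ≡⟨ ℕ.*-comm 2 n ⟩
    n ℕ.* 2            ≤⟨ ℕ.*-monoˡ-≤ 2 n≤ ⟩
    (p ∸ 1) ℕ./ 2 ℕ.* 2 ≤⟨ ℕ.m/n*n≤m (p ∸ 1) 2 ⟩
    p ∸ 1              <⟨ ℕ.∸-monoʳ-< (s≤s z≤n) (ℕ.≤-trans (s≤s z≤n) 2<p) ⟩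
    p                  ∎
    where open ℕ.≤-Reasoning

  -- Signed roots have absolute value at most `n`, and `n + n < p`, so two that are congruent modulo
  -- `p` are equal as integers.
  ◃-root-mod-injective : ∀ {ε η} {u v : Fin n} →
    + p ∣ℤ (ε ◃ root u) ℤ.- (η ◃ root v) → ε ≡ η × u ≡ v
  ◃-root-mod-injective {ε} {η} {u} {v} p∣ =
    ◃-root-injective (∣i-j∣∧<⇒≡ p∣ (ℕ.≤-<-trans (ℕ.+-mono-≤ (bound ε u) (bound η v)) n+n<p))
    where
    bound : ∀ ε (u : Fin n) → ℤ.∣ ε ◃ root u ∣ ℕ.≤ n
    bound ε u = subst (ℕ._≤ n) (sym (ℤ.abs-◃ ε (root u))) (Fin.toℕ<n u)

  square-mod-injective : ∀ {u v : Fin n} → + p ∣ℤ square u ℤ.- square v → u ≡ v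
  square-mod-injective {u} {v} p∣ =
    [ proj₂ ∘ ◃-root-mod-injective {Sign.+} {Sign.+} {u} {v}
    -- The sum of two roots is read as a difference whose second root is negated. The case is
    -- absurd, as it also yields `Sign.+ ≡ Sign.-`, but it still supplies `u ≡ v`.
    , proj₂ ∘ ◃-root-mod-injective {Sign.+} {Sign.-} {u} {v} ]′
    (prime∣i*j p-prime (+ root u ℤ.- + root v) (+ root u ℤ.+ + root v)
      (subst (+ p ∣ℤ_) (identity (+ root u) (+ root v)) p∣))
    where
    identity : ∀ x y → x ℤ.* x ℤ.- y ℤ.* y ≡ (x ℤ.- y) ℤ.* (x ℤ.+ y)
    identity = solve-∀

  -- Choosing signs for both roots makes `L±` four times as long as `L`. The residue `t` of `y - x`
  -- embeds `L±` into 1, ..., p - 1, so `4 |L| ≤ p - 1`.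
  square-differences : ∀ {d} → ¬ + p ∣ℤ d → {L : List (Fin n × Fin n)} → Unique L →
    (∀ {u v} → (u , v) ∈ L → + p ∣ℤ square v ℤ.- square u ℤ.- d) →
    length L ℕ.≤ (p ∸ 1) ℕ./ 4
  square-differences {d} p∤d {L} !L L-diff = begin
    length L                  ≡⟨ ℕ.m*n/n≡m (length L) 4 ⟨
    (length L ℕ.* 4) ℕ./ 4    ≡⟨ cong (ℕ._/ 4) (length-cartesianProduct L signs) ⟨
    length L± ℕ./ 4           ≤⟨ ℕ./-monoˡ-≤ 4 L±-bound ⟩
    (p ∸ 1) ℕ./ 4             ∎
    where
    open ℕ.≤-Reasoning
    signs : List (Sign × Sign)
    signs = (Sign.+ , Sign.+) ∷ (Sign.+ , Sign.-) ∷ (Sign.- , Sign.+) ∷ (Sign.- , Sign.-) ∷ []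

    !signs : Unique signs
    !signs = ((λ ()) ∷ (λ ()) ∷ (λ ()) ∷ []) ∷ ((λ ()) ∷ (λ ()) ∷ []) ∷ ((λ ()) ∷ []) ∷ [] ∷ []

    L± = cartesianProduct L signs

    instance
      p≢0 : NonZero p
      p≢0 = ℕ.>-nonZero (ℕ.≤-trans (s≤s z≤n) 2<p)

    x y : (Fin n × Fin n) × (Sign × Sign) → ℤ
    x ((u , _) , (ε , _)) = ε ◃ root u
    y ((_ , v) , (_ , η)) = η ◃ root v

    t : (Fin n × Fin n) × (Sign × Sign) → ℕ
    t z = (y z ℤ.- x z) %ℕ p

    y²-x² : ∀ {z} → z ∈ L± → + p ∣ℤ y z ℤ.* y z ℤ.- x z ℤ.* x z ℤ.- d
    y²-x² {(u , v) , (ε , η)} z∈ =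
      subst (+ p ∣ℤ_) (cong (ℤ._- d) (sym (cong₂ ℤ._-_ (◃-square η (root v)) (◃-square ε (root u)))))
        (L-diff (proj₁ (∈-cartesianProduct⁻ L signs z∈)))

    t-nonZero : ∀ {z} → z ∈ L± → t z ≢ 0
    t-nonZero {z} z∈ tz≡0 = contradiction (%ℕ≡0⇒∣ (y z ℤ.- x z) p tz≡0) (∤y-x {x = x z} {y z} p∤d (y²-x² z∈))

    t∈ : ∀ {z} → z ∈ L± → t z ∈ applyUpTo suc (p ∸ 1)
    t∈ {z} z∈ = ∈-[1‥p-1] (t-nonZero z∈) (ℤ.n%ℕd<d (y z ℤ.- x z) p)

    t-injective : ∀ {z w} → z ∈ L± → w ∈ L± → t z ≡ t w → z ≡ w
    t-injective {z} {w} z∈ w∈ eq =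
      let p∣x , p∣y = root-difference-determines p-prime {d} {x z} {y z} {x w} {y w} 2<p p∤d (y²-x² z∈) (y²-x² w∈)
                        (%ℕ≡⇒∣ (y z ℤ.- x z) (y w ℤ.- x w) p eq)
          ε≡ , u≡ = ◃-root-mod-injective p∣x
          η≡ , v≡ = ◃-root-mod-injective p∣y
      in cong₂ _,_ (cong₂ _,_ u≡ v≡) (cong₂ _,_ ε≡ η≡)

    L±-bound : length L± ℕ.≤ p ∸ 1
    L±-bound = subst (length L± ℕ.≤_) (length-applyUpTo suc (p ∸ 1))
      (length-injection t (cartesianProduct⁺ !L !signs) t∈ t-injective)

-- Counting in lists

length-allFin : ∀ n → length (allFin n) ≡ n
length-allFin n = length-tabulate {n = n} (λ i → i)

length-filter-map : {P : Pred B 0ℓ} (P? : Decidable P) (f : A → B) (xs : List A) →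
  length (filter P? (map f xs)) ≡ length (filter (P? ∘ f) xs)
length-filter-map P? f []       = refl
length-filter-map P? f (x ∷ xs) with P? (f x)
... | yes _ = cong suc (length-filter-map P? f xs)
... | no  _ = length-filter-map P? f xs

length-filter-⊎ : {P Q R : Pred A 0ℓ} (P? : Decidable P) (Q? : Decidable Q) (R? : Decidable R) →
  (∀ {x} → P x → Q x ⊎ R x) → (xs : List A) →
  length (filter P? xs) ℕ.≤ length (filter Q? xs) ℕ.+ length (filter R? xs)
length-filter-⊎ P? Q? R? split []       = z≤n
length-filter-⊎ P? Q? R? split (x ∷ xs) with length-filter-⊎ P? Q? R? split xs | P? x | Q? x | R? x
... | ih | no  _ | no  _ | no  _ = ih
... | ih | no  _ | no  _ | yes _ = ℕ.≤-trans ih (ℕ.+-monoʳ-≤ _ (ℕ.n≤1+n _))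
... | ih | no  _ | yes _ | no  _ = ℕ.m≤n⇒m≤1+n ih
... | ih | no  _ | yes _ | yes _ = ℕ.≤-trans ih (ℕ.+-mono-≤ (ℕ.n≤1+n _) (ℕ.n≤1+n _))
... | ih | yes _ | no  _ | yes _ = ℕ.≤-trans (s≤s ih) (ℕ.≤-reflexive (sym (ℕ.+-suc _ _)))
... | ih | yes _ | yes _ | no  _ = s≤s ih
... | ih | yes _ | yes _ | yes _ = s≤s (ℕ.≤-trans ih (ℕ.+-monoʳ-≤ _ (ℕ.n≤1+n _)))
... | ih | yes p | no ¬q | no ¬r = contradiction (split p) [ ¬q , ¬r ]′

cartesianProduct-map : (f : A → B) (xs ys : List A) →
  cartesianProduct (map f xs) (map f ys) ≡ map (λ (x , y) → f x , f y) (cartesianProduct xs ys)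
cartesianProduct-map f []       ys = refl
cartesianProduct-map f (x ∷ xs) ys =
  trans (cong₂ _++_ (trans (sym (map-∘ ys)) (map-∘ ys)) (cartesianProduct-map f xs ys))
        (sym (map-++ _ (map (x ,_) ys) (cartesianProduct xs ys)))

differenceCount-map : (f : A → ℤ) (xs : List A) (d : ℤ) →
  differenceCount (map f xs) d
    ≡ length (filter (λ (x , y) → (f y ℤ.- f x) ℤ.≟ d) (cartesianProduct xs xs))
differenceCount-map f xs d =
  trans (cong (length ∘ filter _) (cartesianProduct-map f xs xs))
        (length-filter-map _ _ (cartesianProduct xs xs))

length-Σ-upTo : (k : A → ℕ) (xs : List A) →
  length (concatMap (λ x → map (x ,_) (upTo (k x))) xs) ≡ sum (map k xs)
length-Σ-upTo k []       = refl
length-Σ-upTo k (x ∷ xs) =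
  trans (length-++ (map (x ,_) (upTo (k x))))
        (cong₂ ℕ._+_ (trans (length-map _ (upTo (k x))) (length-upTo (k x))) (length-Σ-upTo k xs))

+-interchange : ∀ a b c d → (a ℕ.+ b) ℕ.+ (c ℕ.+ d) ≡ (a ℕ.+ c) ℕ.+ (b ℕ.+ d)
+-interchange = ℕ.solve-∀

sum-∸ : ∀ {t} (k : A → ℕ) (xs : List A) → (∀ x → k x ℕ.≤ t) →
  sum (map (λ x → t ∸ k x) xs) ℕ.+ sum (map k xs) ≡ length xs ℕ.* t
sum-∸     k []       k≤ = refl
sum-∸ {t = t} k (x ∷ xs) k≤ =
  trans (+-interchange (t ∸ k x) _ (k x) _) (cong₂ ℕ._+_ (ℕ.m∸n+n≡m (k≤ x)) (sum-∸ k xs k≤))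

-- Multiplicities and shortfalls

multiplicity : ℕ → List ℕ → ℕ
multiplicity k = length ∘ filter (ℕ._≟ k)

countBelow : ℕ → List ℕ → ℕ
countBelow t = length ∘ filter (ℕ._<? t)

-- Truncated subtraction lets entries above `t` contribute 0, so only what is missing below the
-- level `t` is measured.
shortfall : ℕ → List ℕ → ℕ
shortfall t = sum ∘ map (t ∸_)

countBelow-suc : ∀ t xs → countBelow (suc t) xs ℕ.≤ multiplicity t xs ℕ.+ countBelow t xs
countBelow-suc t = length-filter-⊎ (ℕ._<? suc t) (ℕ._≟ t) (ℕ._<? t) λ {x} x<1+t →
  Sum.swap (ℕ.m≤n⇒m<n∨m≡n (ℕ.s≤s⁻¹ x<1+t))

-- Raising the level by one adds one unit for each entry below `suc t`; every other entry
-- contributes 0 at both levels.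
shortfall-suc : ∀ t xs → shortfall (suc t) xs ℕ.≤ countBelow (suc t) xs ℕ.+ shortfall t xs
shortfall-suc t []       = z≤n
shortfall-suc t (x ∷ xs) with shortfall-suc t xs | x ℕ.<? suc t
... | ih | yes x<1+t = begin
  suc t ∸ x ℕ.+ shortfall (suc t) xs
    ≡⟨ cong (ℕ._+ shortfall (suc t) xs) (ℕ.+-∸-assoc 1 (ℕ.s≤s⁻¹ x<1+t)) ⟩
  suc (t ∸ x) ℕ.+ shortfall (suc t) xs
    ≤⟨ ℕ.+-monoʳ-≤ (suc (t ∸ x)) ih ⟩
  suc (t ∸ x) ℕ.+ (countBelow (suc t) xs ℕ.+ shortfall t xs)
    ≡⟨ swap (t ∸ x) (countBelow (suc t) xs) (shortfall t xs) ⟩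
  suc (countBelow (suc t) xs) ℕ.+ shortfall t (x ∷ xs)
    ≡⟨ cong (λ ys → length ys ℕ.+ shortfall t (x ∷ xs)) (filter-accept (ℕ._<? suc t) x<1+t) ⟨
  countBelow (suc t) (x ∷ xs) ℕ.+ shortfall t (x ∷ xs) ∎
  where
  open ℕ.≤-Reasoning
  swap : ∀ a b c → suc a ℕ.+ (b ℕ.+ c) ≡ suc b ℕ.+ (a ℕ.+ c)
  swap = ℕ.solve-∀
... | ih | no x≮1+t = begin
  suc t ∸ x ℕ.+ shortfall (suc t) xs
    ≡⟨ cong (ℕ._+ shortfall (suc t) xs) (ℕ.m≤n⇒m∸n≡0 (ℕ.≮⇒≥ x≮1+t)) ⟩
  shortfall (suc t) xs
    ≤⟨ ih ⟩
  countBelow (suc t) xs ℕ.+ shortfall t xs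
    ≤⟨ ℕ.+-monoʳ-≤ (countBelow (suc t) xs) (ℕ.m≤n+m (shortfall t xs) (t ∸ x)) ⟩
  countBelow (suc t) xs ℕ.+ shortfall t (x ∷ xs)
    ≡⟨ cong (λ ys → length ys ℕ.+ shortfall t (x ∷ xs)) (filter-reject (ℕ._<? suc t) x≮1+t) ⟨
  countBelow (suc t) (x ∷ xs) ℕ.+ shortfall t (x ∷ xs) ∎
  where open ℕ.≤-Reasoning

length*t≤sum+shortfall : ∀ t xs → length xs ℕ.* t ℕ.≤ sum xs ℕ.+ shortfall t xs
length*t≤sum+shortfall t []       = z≤n
length*t≤sum+shortfall t (x ∷ xs) = begin
  t ℕ.+ length xs ℕ.* t                             ≤⟨ ℕ.+-mono-≤ (ℕ.m≤n+m∸n t x) (length*t≤sum+shortfall t xs) ⟩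
  (x ℕ.+ (t ∸ x)) ℕ.+ (sum xs ℕ.+ shortfall t xs)   ≡⟨ +-interchange x (t ∸ x) (sum xs) _ ⟩
  (x ℕ.+ sum xs) ℕ.+ (t ∸ x ℕ.+ shortfall t xs)     ∎
  where
  open ℕ.≤-Reasoning

module _ {g m : ℕ} {xs : List ℕ} (m≤xs : All (m ℕ.≤_) xs) (mult≤g : ∀ k → multiplicity k xs ℕ.≤ g) where

  -- Below `k + m` only the `k` values m, ..., k + m - 1 are possible, each at most `g` times.
  countBelow-≤ : ∀ k → countBelow (k ℕ.+ m) xs ℕ.≤ k ℕ.* g
  countBelow-≤ zero    = ℕ.≤-reflexive (cong length (filter-none (ℕ._<? m) (All.map ℕ.≤⇒≯ m≤xs)))
  countBelow-≤ (suc k) = ℕ.≤-trans (countBelow-suc (k ℕ.+ m) xs) (ℕ.+-mono-≤ (mult≤g (k ℕ.+ m)) (countBelow-≤ k))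

  -- Raising the level from `m` in `k` unit steps adds at most g, 2g, ..., kg in turn. The factor 2
  -- avoids halving `k (k + 1)`.
  shortfall-≤ : ∀ k → 2 ℕ.* shortfall (k ℕ.+ m) xs ℕ.≤ g ℕ.* (k ℕ.* suc k)
  shortfall-≤ zero    = ℕ.≤-reflexive (trans (cong (2 ℕ.*_) (shortfall-base m≤xs)) (sym (ℕ.*-zeroʳ g)))
    where
    shortfall-base : ∀ {ys} → All (m ℕ.≤_) ys → shortfall m ys ≡ 0
    shortfall-base []         = refl
    shortfall-base (m≤y ∷ m≤) = cong₂ ℕ._+_ (ℕ.m≤n⇒m∸n≡0 m≤y) (shortfall-base m≤)
  shortfall-≤ (suc k) = begin
    2 ℕ.* shortfall (suc k ℕ.+ m) xs
      ≤⟨ ℕ.*-monoʳ-≤ 2 (ℕ.≤-trans (shortfall-suc (k ℕ.+ m) xs) (ℕ.+-monoˡ-≤ _ (countBelow-≤ (suc k)))) ⟩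
    2 ℕ.* (suc k ℕ.* g ℕ.+ shortfall (k ℕ.+ m) xs)
      ≡⟨ ℕ.*-distribˡ-+ 2 (suc k ℕ.* g) _ ⟩
    2 ℕ.* (suc k ℕ.* g) ℕ.+ 2 ℕ.* shortfall (k ℕ.+ m) xs
      ≤⟨ ℕ.+-monoʳ-≤ (2 ℕ.* (suc k ℕ.* g)) (shortfall-≤ k) ⟩
    2 ℕ.* (suc k ℕ.* g) ℕ.+ g ℕ.* (k ℕ.* suc k)
      ≡⟨ triangular g k ⟩
    g ℕ.* (suc k ℕ.* suc (suc k)) ∎
    where
    open ℕ.≤-Reasoning
    triangular : ∀ g k → 2 ℕ.* (suc k ℕ.* g) ℕ.+ g ℕ.* (k ℕ.* suc k) ≡ g ℕ.* (suc k ℕ.* suc (suc k))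
    triangular = ℕ.solve-∀

  -- The height `k` stays free here; the theorem takes it to be the quotient `a`, the number of
  -- values that `n` entries can fill with `g` copies each.
  sum-lower-bound : ∀ k → 2 ℕ.* (length xs ℕ.* (k ℕ.+ m)) ℕ.≤ 2 ℕ.* sum xs ℕ.+ g ℕ.* (k ℕ.* suc k)
  sum-lower-bound k = begin
    2 ℕ.* (length xs ℕ.* (k ℕ.+ m))                 ≤⟨ ℕ.*-monoʳ-≤ 2 (length*t≤sum+shortfall (k ℕ.+ m) xs) ⟩
    2 ℕ.* (sum xs ℕ.+ shortfall (k ℕ.+ m) xs)       ≡⟨ ℕ.*-distribˡ-+ 2 (sum xs) _ ⟩
    2 ℕ.* sum xs ℕ.+ 2 ℕ.* shortfall (k ℕ.+ m) xs   ≤⟨ ℕ.+-monoʳ-≤ (2 ℕ.* sum xs) (shortfall-≤ k) ⟩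
    2 ℕ.* sum xs ℕ.+ g ℕ.* (k ℕ.* suc k)            ∎
    where open ℕ.≤-Reasoning

-- Cutting a modular Golomb ruler

-- Cutting only concerns residues, so squares do not appear. `s-golomb` speaks of arbitrary
-- duplicate-free lists of pairs because it is applied both to all pairs with a given difference and
-- to the pairs `(v , farthest v)`.
module ModularRuler {p g n : ℕ} .{{_ : NonZero p}} .{{_ : NonZero n}} (1≤g : 1 ℕ.≤ g) (s : Fin n → ℤ)
  (s-injective : ∀ {u v} → + p ∣ℤ s u ℤ.- s v → u ≡ v)
  (s-golomb : ∀ {d} → ¬ + p ∣ℤ d → {L : List (Fin n × Fin n)} → Unique L →
    (∀ {u v} → (u , v) ∈ L → + p ∣ℤ s v ℤ.- s u ℤ.- d) → length L ℕ.≤ g)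
  where

  private
    first : ∀ {k} .{{_ : NonZero k}} → Fin k
    first {suc k} = Fin.zero

  module _ (f : Fin n → ℤ) (p∣f-s : ∀ x → + p ∣ℤ f x ℤ.- s x) (∣f-f∣<p : ∀ u v → ℤ.∣ f v ℤ.- f u ∣ ℕ.< p) where

    private
      hasDifference? : ∀ d → Decidable {A = Fin n × Fin n} (λ (u , v) → f v ℤ.- f u ≡ d)
      hasDifference? d (u , v) = (f v ℤ.- f u) ℤ.≟ d

      pairs = cartesianProduct (allFin n) (allFin n)

    representatives-injective : ∀ {u v} → f u ≡ f v → u ≡ v
    representatives-injective {u} {v} eq = s-injective (subst (+ p ∣ℤ_) (identity (f v) (s u) (s v))
      (∣m∣n⇒∣m-n (p∣f-s v) (subst (λ m → + p ∣ℤ m ℤ.- s u) eq (p∣f-s u))))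
      where
      identity : ∀ m a b → m ℤ.- b ℤ.- (m ℤ.- a) ≡ a ℤ.- b
      identity = solve-∀

    representatives-difference≢ : ∀ {d u v} → 0ℤ ℤ.< d → + p ∣ℤ d → f v ℤ.- f u ≢ d
    representatives-difference≢ {d} {u} {v} 0<d p∣d eq =
      ℤ.<-irrefl (sym (∣∧∣i∣<⇒≡0 p∣d (subst (λ d → ℤ.∣ d ∣ ℕ.< p) eq (∣f-f∣<p u v)))) 0<d

    -- A positive multiple of `p` is not a difference, since all differences are below `p` in
    -- absolute value. For any other `d`, passing from `f` to `s` preserves differences modulo `p`,
    -- and `s-golomb` counts the pairs.
    representatives-pairs : ∀ d → 0ℤ ℤ.< d → length (filter (hasDifference? d) pairs) ℕ.≤ g
    representatives-pairs d 0<d with + p ∣ℤ? d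
    ... | yes p∣d = ℕ.≤-trans (ℕ.≤-reflexive (cong length (filter-none (hasDifference? d)
                      (All.universal (λ _ → representatives-difference≢ 0<d p∣d) pairs)))) z≤n
    ... | no p∤d = s-golomb p∤d (filter⁺ (hasDifference? d) (cartesianProduct⁺ (allFin⁺ n) (allFin⁺ n))) λ {u} {v} uv∈ →
      subst (λ d → + p ∣ℤ s v ℤ.- s u ℤ.- d) (proj₂ (∈-filter⁻ (hasDifference? d) {xs = pairs} uv∈))
        (subst (+ p ∣ℤ_) (identity (f u) (f v) (s u) (s v)) (∣m∣n⇒∣m-n (p∣f-s u) (p∣f-s v)))
      where
      identity : ∀ m n a b → (m ℤ.- a) ℤ.- (n ℤ.- b) ≡ b ℤ.- a ℤ.- (n ℤ.- m)
      identity = solve-∀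

    representatives-isGolomb : IsGolombRuler g (map f (allFin n))
    representatives-isGolomb = map⁺ representatives-injective (allFin⁺ n) , λ d 0<d →
      subst (ℕ._≤ g) (sym (differenceCount-map f (allFin n) d)) (representatives-pairs d 0<d)

  -- The distance from `v` to `x` round the circle in the positive direction.
  δ : Fin n → Fin n → ℕ
  δ v x = (s x ℤ.- s v) %ℕ p

  -- The last mark met on a turn that starts at `v`, hence the cyclic predecessor of `v`, or `v`
  -- itself if it is the only mark.
  farthest : Fin n → Fin n
  farthest v = argmax (δ v) first (allFin n)

  ecc : Fin n → ℕ
  ecc v = δ v (farthest v)

  δ<p : ∀ v x → δ v x ℕ.< p
  δ<p v x = ℤ.n%ℕd<d (s x ℤ.- s v) p

  p∣δ : ∀ v x → + p ∣ℤ + δ v x ℤ.- (s x ℤ.- s v)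
  p∣δ v x = n∣i%ℕn-i (s x ℤ.- s v) p

  δ≤ecc : ∀ v x → δ v x ℕ.≤ ecc v
  δ≤ecc v x = All.lookup (f[xs]≤f[argmax] {f = δ v} first (allFin n)) (∈-allFin x)

  module _ (z : ℕ) where

    after : Fin n → ℕ
    after v = (s v ℤ.- + z) %ℕ p

    -- The first mark met when moving forward from `z`, with `z` itself included.
    next : Fin n
    next = argmin after first (allFin n)

    p∣after : ∀ v → + p ∣ℤ + after v ℤ.- (s v ℤ.- + z)
    p∣after v = n∣i%ℕn-i (s v ℤ.- + z) p

    -- Otherwise the point farthest from `next` would come between z and `next`.
    after-next : after next ℕ.+ ecc next ℕ.< p
    after-next = ℕ.≰⇒> λ p≤ →
      let x = farthest next
          i = after next
          e = ecc next
          -- As `e < p`, one subtraction brings `i + e` below `i`. The result is the residue of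
          -- `s x - z`, that is `after x`, and contradicts the minimality of `i`.
          wrap = i ℕ.+ e ∸ p
          wrap<i : wrap ℕ.< i
          wrap<i = ℕ.+-cancelʳ-< p wrap i (subst (ℕ._< i ℕ.+ p) (sym (ℕ.m∸n+n≡m p≤)) (ℕ.+-monoʳ-< i (δ<p next x)))
          wrap+p : + wrap ℤ.+ + p ≡ + i ℤ.+ + e
          wrap+p = cong +_ (ℕ.m∸n+n≡m p≤)
          p∣diff : + p ∣ℤ + wrap ℤ.- + after x
          p∣diff = subst (+ p ∣ℤ_)
            (trans (identity₁ (+ i) (+ e) (+ after x) (s next) (s x) (+ z) (+ p))
              (trans (cong (λ w → w ℤ.- + p ℤ.- + after x) (sym wrap+p))
                     (identity₂ (+ wrap) (+ p) (+ after x))))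
            (∣m∣n⇒∣m-n (∣m∣n⇒∣m-n (∣m∣n⇒∣m+n (p∣after next) (p∣δ next x)) (p∣after x)) (divides 1ℤ (sym (ℤ.*-identityˡ (+ p)))))
          wrap≡ : wrap ≡ after x
          wrap≡ = ∣+m-+n⇒m≡n (ℕ.<-trans wrap<i (ℤ.n%ℕd<d (s next ℤ.- + z) p)) (ℤ.n%ℕd<d (s x ℤ.- + z) p) p∣diff
      in contradiction (All.lookup (f[argmin]≤f[xs] {f = after} first (allFin n)) (∈-allFin x))
           (ℕ.<⇒≱ (subst (ℕ._< i) wrap≡ wrap<i))
      where
      identity₁ : ∀ i e j a b z p →
        (i ℤ.- (a ℤ.- z)) ℤ.+ (e ℤ.- (b ℤ.- a)) ℤ.- (j ℤ.- (b ℤ.- z)) ℤ.- p ≡ i ℤ.+ e ℤ.- p ℤ.- j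
      identity₁ = solve-∀
      identity₂ : ∀ w p j → w ℤ.+ p ℤ.- p ℤ.- j ≡ w ℤ.- j
      identity₂ = solve-∀

  -- Modulo `p`, `z` is recovered as the position of `next z` minus the distance travelled to it.
  next-after-injective : ∀ {y z} → y ℕ.< p → z ℕ.< p →
    (next y , after y (next y)) ≡ (next z , after z (next z)) → y ≡ z
  next-after-injective {y} {z} y<p z<p eq = ∣+m-+n⇒m≡n y<p z<p
    (subst (+ p ∣ℤ_) (identity (+ after y (next y)) (s (next y)) (+ y) (+ z))
      (∣m∣n⇒∣m-n (p∣after y (next y))
        (subst (λ (v , i) → + p ∣ℤ + i ℤ.- (s v ℤ.- + z)) (sym eq) (p∣after z (next z)))))
    where
    identity : ∀ i a y z → i ℤ.- (a ℤ.- y) ℤ.- (i ℤ.- (a ℤ.- z)) ≡ y ℤ.- z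
    identity = solve-∀

  -- The arcs of length p - ecc v ending at the points v cover the circle ℤ/p.
  p≤sum-gaps : p ℕ.≤ sum (map (λ v → p ∸ ecc v) (allFin n))
  p≤sum-gaps = begin
    p                                            ≡⟨ length-upTo p ⟨
    length (upTo p)                              ≤⟨ length-injection (λ z → next z , after z (next z)) (upTo⁺ p) covered
                                                      (λ y∈ z∈ → next-after-injective (∈-upTo⁻ y∈) (∈-upTo⁻ z∈)) ⟩
    length arcs                                  ≡⟨ length-Σ-upTo (λ v → p ∸ ecc v) (allFin n) ⟩
    sum (map (λ v → p ∸ ecc v) (allFin n))       ∎
    where
    open ℕ.≤-Reasoning
    arcs : List (Fin n × ℕ)
    arcs = concatMap (λ v → map (v ,_) (upTo (p ∸ ecc v))) (allFin n)
    covered : ∀ {z} → z ∈ upTo p → (next z , after z (next z)) ∈ arcs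
    covered {z} _ = Any.concatMap⁺ _ (Any.map
      (λ where refl → ∈-map⁺ (next z ,_) (∈-upTo⁺ (ℕ.m+n≤o⇒m≤o∸n _ (after-next z))))
      (∈-allFin (next z)))

  sum-ecc : sum (map ecc (allFin n)) ℕ.+ p ℕ.≤ n ℕ.* p
  sum-ecc = begin
    sum (map ecc (allFin n)) ℕ.+ p               ≤⟨ ℕ.+-monoʳ-≤ (sum (map ecc (allFin n))) p≤sum-gaps ⟩
    sum (map ecc (allFin n)) ℕ.+ sum (map (λ v → p ∸ ecc v) (allFin n))
                                                 ≡⟨ ℕ.+-comm (sum (map ecc (allFin n))) _ ⟩
    sum (map (λ v → p ∸ ecc v) (allFin n)) ℕ.+ sum (map ecc (allFin n))
                                                 ≡⟨ sum-∸ ecc (allFin n) (λ v → ℕ.<⇒≤ (δ<p v (farthest v))) ⟩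
    length (allFin n) ℕ.* p                      ≡⟨ cong (ℕ._* p) (length-allFin n) ⟩
    n ℕ.* p                                      ∎
    where open ℕ.≤-Reasoning

  -- If even the farthest mark is at distance 0, all marks are congruent to `s v`.
  ecc≡0⇒unique : ∀ {u v} → ecc v ≡ 0 → u ≡ v
  ecc≡0⇒unique {u} {v} eq =
    s-injective (%ℕ≡0⇒∣ (s u ℤ.- s v) p (ℕ.n≤0⇒n≡0 (subst (δ v u ℕ.≤_) eq (δ≤ecc v u))))

  -- For `0 < k < p`, the marks of eccentricity `k` give pairs `(v , farthest v)` of difference `k`,
  -- distinct by their first components, so `s-golomb` bounds their number.
  ecc-multiplicity : ∀ k → multiplicity k (map ecc (allFin n)) ℕ.≤ g
  ecc-multiplicity k = subst (ℕ._≤ g) (sym (length-filter-map (ℕ._≟ k) ecc (allFin n))) (bound k)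
    where
    fibre : ℕ → List (Fin n)
    fibre k = filter (λ v → ecc v ℕ.≟ k) (allFin n)

    fibre-unique : ∀ k → Unique (fibre k)
    fibre-unique k = filter⁺ (λ v → ecc v ℕ.≟ k) (allFin⁺ n)

    ∈-fibre⁻ : ∀ {k v} → v ∈ fibre k → ecc v ≡ k
    ∈-fibre⁻ {k} v∈ = proj₂ (∈-filter⁻ (λ v → ecc v ℕ.≟ k) {xs = allFin n} v∈)

    bound : ∀ k → length (fibre k) ℕ.≤ g
    -- The class 0 is outside the scope of `s-golomb`, but eccentricity 0 leaves at most one mark,
    -- and `1 ≤ g`.
    bound zero = ℕ.≤-trans
      (length-injection {ys = tt ∷ []} (const tt) (fibre-unique 0) (λ _ → here refl)
        (λ _ v∈ _ → ecc≡0⇒unique (∈-fibre⁻ v∈)))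
      1≤g
    bound k@(suc _) with k ℕ.<? p
    ... | no k≮p = ℕ.≤-trans (ℕ.≤-reflexive (cong length (filter-none (λ v → ecc v ℕ.≟ k)
            (All.tabulate {xs = allFin n} λ {v} _ eq → k≮p (subst (ℕ._< p) eq (δ<p v (farthest v))))))) z≤n
    ... | yes k<p = subst (ℕ._≤ g) (length-map _ (fibre k))
      (s-golomb {+ k} (λ p∣k → ℕ.>⇒∤ k<p (∣⇒∣ᵤ p∣k)) (map⁺ ,-injectiveˡ (fibre-unique k)) λ uv∈ →
        let v , v∈ , eq = ∈-map⁻ (λ v → v , farthest v) uv∈
        in subst (λ (u , v) → + p ∣ℤ s v ℤ.- s u ℤ.- + k) (sym eq)
             (subst (λ k → + p ∣ℤ s (farthest v) ℤ.- s v ℤ.- + k) (∈-fibre⁻ v∈)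
               (subst (+ p ∣ℤ_) (identity (+ ecc v) (s (farthest v) ℤ.- s v)) (∣m⇒∣-m (p∣δ v (farthest v))))))
      where
      identity : ∀ k a → ℤ.- (k ℤ.- a) ≡ a ℤ.- k
      identity = solve-∀

  -- The mark that follows a largest gap: cutting there gives the shortest ruler among all cuts.
  start : Fin n
  start = argmin ecc first (allFin n)

  span : ℕ
  span = ecc start

  -- The eccentricities are at least `span` and repeat at most `g` times, which bounds their sum
  -- from below; `sum-ecc` bounds it from above. All terms are kept additive to stay in `ℕ`.
  span-bound : ∀ k → 2 ℕ.* (p ℕ.+ n ℕ.* (k ℕ.+ span)) ℕ.≤ 2 ℕ.* (n ℕ.* p) ℕ.+ g ℕ.* (k ℕ.* suc k)
  span-bound k = begin
    2 ℕ.* (p ℕ.+ n ℕ.* (k ℕ.+ span))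
      ≡⟨ ℕ.*-distribˡ-+ 2 p _ ⟩
    2 ℕ.* p ℕ.+ 2 ℕ.* (n ℕ.* (k ℕ.+ span))
      ≡⟨ cong (λ l → 2 ℕ.* p ℕ.+ 2 ℕ.* (l ℕ.* (k ℕ.+ span))) (trans (length-map ecc (allFin n)) (length-allFin n)) ⟨
    2 ℕ.* p ℕ.+ 2 ℕ.* (length eccs ℕ.* (k ℕ.+ span))
      ≤⟨ ℕ.+-monoʳ-≤ (2 ℕ.* p) (sum-lower-bound (All.map⁺ (f[argmin]≤f[xs] {f = ecc} first (allFin n))) ecc-multiplicity k) ⟩
    2 ℕ.* p ℕ.+ (2 ℕ.* sum eccs ℕ.+ g ℕ.* (k ℕ.* suc k))
      ≡⟨ identity p (sum eccs) (g ℕ.* (k ℕ.* suc k)) ⟩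
    2 ℕ.* (sum eccs ℕ.+ p) ℕ.+ g ℕ.* (k ℕ.* suc k)
      ≤⟨ ℕ.+-monoˡ-≤ (g ℕ.* (k ℕ.* suc k)) (ℕ.*-monoʳ-≤ 2 sum-ecc) ⟩
    2 ℕ.* (n ℕ.* p) ℕ.+ g ℕ.* (k ℕ.* suc k) ∎
    where
    open ℕ.≤-Reasoning
    eccs = map ecc (allFin n)
    identity : ∀ p e t → 2 ℕ.* p ℕ.+ (2 ℕ.* e ℕ.+ t) ≡ 2 ℕ.* (e ℕ.+ p) ℕ.+ t
    identity = ℕ.solve-∀

  -- The representative of `s x` in the window of length `p` that begins at `s start`.
  mark : Fin n → ℤ
  mark x = s start ℤ.+ + δ start x

  ruler : List ℤ
  ruler = map mark (allFin n)

  p∣mark : ∀ x → + p ∣ℤ mark x ℤ.- s x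
  p∣mark x = subst (+ p ∣ℤ_) (identity (+ δ start x) (s x) (s start)) (p∣δ start x)
    where
    identity : ∀ d a b → d ℤ.- (a ℤ.- b) ≡ b ℤ.+ d ℤ.- a
    identity = solve-∀

  ruler-isGolomb : IsGolombRuler g ruler
  ruler-isGolomb = representatives-isGolomb mark p∣mark λ u v →
    subst (λ d → ℤ.∣ d ∣ ℕ.< p) (sym (identity (s start) (+ δ start v) (+ δ start u)))
      (∣+m-+n∣< (δ<p start v) (δ<p start u))
    where
    identity : ∀ c a b → (c ℤ.+ a) ℤ.- (c ℤ.+ b) ≡ a ℤ.- b
    identity = solve-∀

  length-ruler : length ruler ≡ n
  length-ruler = trans (length-map mark (allFin n)) (length-allFin n)

  ruler-span : All (λ x → s start ℤ.≤ x × x ℤ.≤ s start ℤ.+ + span) ruler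
  ruler-span = All.map⁺ (All.tabulate λ {x} _ →
    ℤ.i≤i+j (s start) (+ δ start x) , ℤ.+-monoʳ-≤ (s start) (ℤ.+≤+ (δ≤ecc start x)))

-- Diameters and the minimal ruler

l+D-l : ∀ l D → l ℤ.+ D ℤ.- l ≡ D
l+D-l = solve-∀

diameter-range : ∀ G → ∃[ l ] All (λ x → l ℤ.≤ x × x ℤ.≤ l ℤ.+ diameter G) G
diameter-range []       = 0ℤ , []
diameter-range (x ∷ xs) = _ , All.zip
  (min≤⊤ x xs ∷ min≤xs x xs , All.map (λ {y} y≤ → subst (y ℤ.≤_) (identity (max x xs) (min x xs)) y≤) (⊥≤max x xs ∷ xs≤max x xs))
  where
  identity : ∀ a b → a ≡ b ℤ.+ (a ℤ.- b)
  identity = solve-∀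

diameter-least : ∀ {l D} → 0ℤ ℤ.≤ D → ∀ {G} → All (λ x → l ℤ.≤ x × x ℤ.≤ l ℤ.+ D) G → diameter G ℤ.≤ D
diameter-least 0≤D []                  = 0≤D
diameter-least {l} {D} 0≤D ((l≤x , x≤u) ∷ range) =
  subst (_ ℤ.≤_) (l+D-l l D)
    (ℤ.+-mono-≤ (max≤v⁺ x≤u (All.map proj₂ range)) (ℤ.neg-mono-≤ (v≤min⁺ l≤x (All.map proj₁ range))))

0≤diameter : ∀ G → 0ℤ ℤ.≤ diameter G
0≤diameter []       = ℤ.≤-refl
0≤diameter (x ∷ xs) = ℤ.i≤j⇒0≤j-i (ℤ.≤-trans (min≤⊤ x xs) (⊥≤max x xs))

translate-isGolomb : ∀ {g G} l → IsGolombRuler g G → IsGolombRuler g (map (ℤ._- l) G)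
translate-isGolomb {g} {G} l (!G , count≤g) =
  map⁺ (λ {x} {y} → AbelianGroup.∙-cancelʳ ℤ.+-0-abelianGroup (ℤ.- l) x y) !G , λ d 0<d →
    subst (ℕ._≤ g) (sym (trans (differenceCount-map (ℤ._- l) G d) (cong length
      (filter-≐ _ _ ((λ {(a , c)} → trans (sym (identity a c l))) , (λ {(a , c)} → trans (identity a c l)))
        (cartesianProduct G G))))) (count≤g d 0<d)
  where
  identity : ∀ a c l → (c ℤ.- l) ℤ.- (a ℤ.- l) ≡ c ℤ.- a
  identity = solve-∀

-- Deciding the existence of rulers

differences : List ℤ → List ℤ
differences G = map (λ (a , c) → c ℤ.- a) (cartesianProduct G G)

-- A value outside `differences G` is counted 0 times, so the condition on all `d` reduces to a
-- finite check.
isGolomb? : ∀ g G → Dec (IsGolombRuler g G)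
isGolomb? g G = unique? G ×-dec map′ everywhere (λ count≤g → All.universal count≤g (differences G))
    (All.all? (λ d → (0ℤ ℤ.<? d) →-dec (differenceCount G d ℕ.≤? g)) (differences G))
  where
  everywhere : All (λ d → 0ℤ ℤ.< d → differenceCount G d ℕ.≤ g) (differences G) →
               ∀ d → 0ℤ ℤ.< d → differenceCount G d ℕ.≤ g
  everywhere count≤g d 0<d with d ∈? differences G
  ... | yes d∈ = All.lookup count≤g d∈ 0<d
  ... | no  d∉ = ℕ.≤-trans (ℕ.≤-reflexive (cong length (filter-none _ (All.tabulate {xs = cartesianProduct G G}
                   λ ac∈ → λ where refl → d∉ (∈-map⁺ _ ac∈))))) z≤n

words : {A : Set} → ℕ → List A → List (List A)
words zero    as = [] ∷ []
words (suc n) as = cartesianProductWith _∷_ as (words n as)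

∈-words : {A : Set} {as xs : List A} → All (_∈ as) xs → xs ∈ words (length xs) as
∈-words []          = here refl
∈-words (x∈ ∷ xs∈) = ∈-cartesianProductWith⁺ _∷_ x∈ (∈-words xs∈)

RulerWithin : ℕ → ℕ → ℤ → Set
RulerWithin g n D = ∃[ G ] IsGolombRuler g G × length G ≡ n × diameter G ℤ.≤ D

-- Translating the lower end to 0 turns every such ruler into a word of length `n` over the letters
-- 0, ..., m, and there are finitely many words.
rulerWithin? : ∀ g n m → Dec (RulerWithin g n (+ m))
rulerWithin? g n m = map′ (λ any → let G , _ , good = find any in G , good) search
    (any? (λ G → isGolomb? g G ×-dec ((length G ℕ.≟ n) ×-dec (diameter G ℤ.≤? + m))) candidates)
  where
  letters = map +_ (upTo (suc m))
  candidates = words n letters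

  ∈-letters : ∀ {x} → 0ℤ ℤ.≤ x → x ℤ.≤ + m → x ∈ letters
  ∈-letters {+ k} _ (ℤ.+≤+ k≤m) = ∈-map⁺ +_ (∈-upTo⁺ (s≤s k≤m))

  search : RulerWithin g n (+ m) → _
  search (G , golomb , len , diam≤m) =
    let l , range = diameter-range G
        range₀ : All (λ x → 0ℤ ℤ.≤ x × x ℤ.≤ 0ℤ ℤ.+ + m) (map (ℤ._- l) G)
        range₀ = All.map⁺ (All.map (λ {x} (l≤x , x≤) → ℤ.i≤j⇒0≤j-i l≤x ,
                   ℤ.≤-trans (subst (x ℤ.- l ℤ.≤_) (l+D-l l (diameter G)) (ℤ.+-monoˡ-≤ (ℤ.- l) x≤)) diam≤m) range)
        len₀ = trans (length-map (ℤ._- l) G) len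
    in lose (subst (λ k → map (ℤ._- l) G ∈ words k letters) len₀
              (∈-words (All.map (λ (0≤x , x≤) → ∈-letters 0≤x x≤) range₀)))
            (translate-isGolomb l golomb , len₀ , diameter-least (ℤ.+≤+ z≤n) range₀)

-- Descent on `m`: either some ruler fits within the next smaller bound, or the ruler at hand is
-- already shortest. At 0 the descent ends because diameters are nonnegative.
minDiameter-exists : ∀ {g n} m → RulerWithin g n (+ m) → ∃[ d ] IsMinDiameter g n d
minDiameter-exists zero (G , golomb , len , diam≤) =
  _ , (G , golomb , len , refl) , λ H _ _ → ℤ.≤-trans diam≤ (0≤diameter H)
minDiameter-exists {g} {n} (suc m) (G , golomb , len , diam≤) with rulerWithin? g n m
... | yes within = minDiameter-exists m within
... | no ¬within = _ , (G , golomb , len , refl) , λ H golombH lenH →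
  ℤ.≤-trans diam≤ (ℤ.i<j⇒suc[i]≤j (ℤ.≰⇒> λ diamH≤m → ¬within (H , golombH , lenH , diamH≤m)))

minDiameter-≤ : ∀ {g n m} → RulerWithin g n (+ m) → ∃[ d ] IsMinDiameter g n d × d ℤ.≤ + m
minDiameter-≤ {m = m} within@(G , golomb , len , diam≤) =
  let d , isMin = minDiameter-exists m within
  in d , isMin , ℤ.≤-trans (proj₂ isMin G golomb len) diam≤

-- Ceilings

i*d≤n⇒i≤n/d : ∀ {i} n d .{{_ : NonZero d}} → i ℤ.* + d ℤ.≤ n → i ℤ.≤ n ℤ./ + d
i*d≤n⇒i≤n/d {i} n d i*d≤n = ℤ.≮⇒≥ λ q<i → ℤ.<⇒≱ (begin-strict
  n                                <⟨ ℤ.n<s[n/ℕd]*d n d ⟩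
  ℤ.suc (n ℤ./ℕ d) ℤ.* + d         ≡⟨ cong (λ q → ℤ.suc q ℤ.* + d) (ℤ.div-pos-is-/ℕ n d) ⟨
  ℤ.suc (n ℤ./ + d) ℤ.* + d        ≤⟨ ℤ.*-monoʳ-≤-nonNeg (+ d) (ℤ.i<j⇒suc[i]≤j q<i) ⟩
  i ℤ.* + d                        ∎) i*d≤n
  where open ℤ.≤-Reasoning

floor-≥ : ∀ q z → z ℤ.* ↧ q ℤ.≤ ↥ q → z ℤ.≤ floor q
floor-≥ q@record{} z = i*d≤n⇒i≤n/d (↥ q) (↧ₙ q)

-- The ceiling of `q` is defined as minus the floor of `- q`, so negation turns the claim into a
-- lower bound for a floor.
ceiling-≤ : ∀ q z → ℚ.toℚᵘ q ℚᵘ.≤ mkℚᵘ z 0 → ceiling q ℤ.≤ z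
ceiling-≤ q@record{} z (*≤* q≤z) = subst (ceiling q ℤ.≤_) (ℤ.neg-involutive z) (ℤ.neg-mono-≤
  (floor-≥ (ℚ.- q) (ℤ.- z)
    (subst₂ ℤ._≤_ (trans (ℤ.neg-distribˡ-* z (↧ q)) (cong (ℤ.- z ℤ.*_) (sym (ℚ.↧-neg q)))) (sym (ℚ.↥-neg q))
      (ℤ.neg-mono-≤ (subst (ℤ._≤ z ℤ.* ↧ q) (ℤ.*-identityʳ (↥ q)) q≤z)))))

toℚᵘ-/ : ∀ i d .{{_ : NonZero d}} → ℚ.toℚᵘ (i / d) ℚᵘ.≃ i ℚᵘ./ d
toℚᵘ-/ i (suc d) = ℚ.toℚᵘ-fromℚᵘ (mkℚᵘ i d)

ceiling-average-≤ : ∀ x y w n .{{_ : NonZero n}} z →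
  + 2 ℤ.* x ℤ.+ y ℤ.+ + 2 ℤ.* w ℤ.≤ z ℤ.* (+ 2 ℤ.* + n) →
  ceiling (((x / 1) ℚ.+ (y / 2) ℚ.+ (w / 1)) ℚ.* (1ℤ / n)) ℤ.≤ z
ceiling-average-≤ x y w n@(suc k) z le = ceiling-≤ q z q≤z
  where
  q = ((x / 1) ℚ.+ (y / 2) ℚ.+ (w / 1)) ℚ.* (1ℤ / n)
  -- Fractions in `ℚᵘ` are not reduced, so numerator and denominator compute and the inequality
  -- becomes one between integers over the denominator `2 n`.
  qᵘ = ((x ℚᵘ./ 1) ℚᵘ.+ (y ℚᵘ./ 2) ℚᵘ.+ (w ℚᵘ./ 1)) ℚᵘ.* (1ℤ ℚᵘ./ n)

  q≃qᵘ : ℚ.toℚᵘ q ℚᵘ.≃ qᵘ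
  q≃qᵘ = ℚᵘ.≃-trans (ℚ.toℚᵘ-homo-* ((x / 1) ℚ.+ (y / 2) ℚ.+ (w / 1)) (1ℤ / n)) (ℚᵘ.*-cong
    (ℚᵘ.≃-trans (ℚ.toℚᵘ-homo-+ ((x / 1) ℚ.+ (y / 2)) (w / 1)) (ℚᵘ.+-cong
      (ℚᵘ.≃-trans (ℚ.toℚᵘ-homo-+ (x / 1) (y / 2)) (ℚᵘ.+-cong (toℚᵘ-/ x 1) (toℚᵘ-/ y 2)))
      (toℚᵘ-/ w 1)))
    (toℚᵘ-/ 1ℤ n))

  identity : ∀ x y w → + 2 ℤ.* x ℤ.+ y ℤ.+ + 2 ℤ.* w
    ≡ ((x ℤ.* + 2 ℤ.+ y ℤ.* + 1) ℤ.* + 1 ℤ.+ w ℤ.* + 2) ℤ.* + 1 ℤ.* + 1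
  identity = solve-∀

  q≤z : ℚ.toℚᵘ q ℚᵘ.≤ mkℚᵘ z 0
  q≤z = ℚᵘ.≤-respˡ-≃ (ℚᵘ.≃-sym q≃qᵘ) (*≤* (subst (ℤ._≤ z ℤ.* (+ 2 ℤ.* + n)) (identity x y w) le))

-- Arithmetic of `n = a g + r`

quotient-nonNeg : ∀ {a r g n} → + n ≡ a ℤ.* + g ℤ.+ r → r ℤ.< + g → 0ℤ ℤ.≤ a
quotient-nonNeg {a} {r} {g} {n} n≡ r<g = ℤ.≮⇒≥ λ a<0 → ℤ.<⇒≱ (begin-strict
  + n                    ≡⟨ n≡ ⟩
  a ℤ.* + g ℤ.+ r        <⟨ ℤ.+-monoʳ-< (a ℤ.* + g) r<g ⟩
  a ℤ.* + g ℤ.+ + g      ≡⟨ identity a (+ g) ⟩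
  ℤ.suc a ℤ.* + g        ≤⟨ ℤ.*-monoʳ-≤-nonNeg (+ g) (ℤ.i<j⇒suc[i]≤j a<0) ⟩
  0ℤ ℤ.* + g             ≡⟨⟩
  0ℤ                     ∎) (ℤ.+≤+ z≤n)
  where
  open ℤ.≤-Reasoning
  identity : ∀ a g → a ℤ.* g ℤ.+ g ≡ (+ 1 ℤ.+ a) ℤ.* g
  identity = solve-∀

-- Rearrangement based on `2nk - gk(k + 1) = gk(k - 1) + 2rk` for `n = kg + r`, which turns the
-- triangular sum of `span-bound` into that of the theorem.
weighted-sum-bound : ∀ p g m k r {n} → n ≡ k ℤ.* g ℤ.+ r →
  + 2 ℤ.* (p ℤ.+ n ℤ.* (k ℤ.+ m)) ℤ.≤ + 2 ℤ.* (n ℤ.* p) ℤ.+ g ℤ.* (k ℤ.* (1ℤ ℤ.+ k)) →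
  + 2 ℤ.* p ℤ.+ g ℤ.* k ℤ.* (k ℤ.- 1ℤ) ℤ.+ + 2 ℤ.* (r ℤ.* k) ℤ.≤ (p ℤ.- m) ℤ.* (+ 2 ℤ.* n)
weighted-sum-bound p g m k r refl le =
  ℤ.0≤i-j⇒j≤i (subst (0ℤ ℤ.≤_) (identity p g m k r) (ℤ.i≤j⇒0≤j-i le))
  where
  identity : ∀ p g m k r →
    (+ 2 ℤ.* ((k ℤ.* g ℤ.+ r) ℤ.* p) ℤ.+ g ℤ.* (k ℤ.* (+ 1 ℤ.+ k)))
      ℤ.- + 2 ℤ.* (p ℤ.+ (k ℤ.* g ℤ.+ r) ℤ.* (k ℤ.+ m))
    ≡ (p ℤ.- m) ℤ.* (+ 2 ℤ.* (k ℤ.* g ℤ.+ r))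
      ℤ.- (+ 2 ℤ.* p ℤ.+ g ℤ.* k ℤ.* (k ℤ.- + 1) ℤ.+ + 2 ℤ.* (r ℤ.* k))
  identity = solve-∀

span-bound⇒ℤ : ∀ p g n m k →
  2 ℕ.* (p ℕ.+ n ℕ.* (k ℕ.+ m)) ℕ.≤ 2 ℕ.* (n ℕ.* p) ℕ.+ g ℕ.* (k ℕ.* suc k) →
  + 2 ℤ.* (+ p ℤ.+ + n ℤ.* (+ k ℤ.+ + m)) ℤ.≤ + 2 ℤ.* (+ n ℤ.* + p) ℤ.+ + g ℤ.* (+ k ℤ.* (1ℤ ℤ.+ + k))
span-bound⇒ℤ p g n m k le = subst₂ ℤ._≤_
  (trans (ℤ.pos-* 2 (p ℕ.+ n ℕ.* (k ℕ.+ m))) (cong (λ z → + 2 ℤ.* (+ p ℤ.+ z)) (ℤ.pos-* n (k ℕ.+ m))))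
  (cong₂ ℤ._+_ (trans (ℤ.pos-* 2 (n ℕ.* p)) (cong (+ 2 ℤ.*_) (ℤ.pos-* n p)))
               (trans (ℤ.pos-* g (k ℕ.* suc k)) (cong (+ g ℤ.*_) (ℤ.pos-* k (suc k)))))
  (ℤ.+≤+ le)

-- The bound for squares modulo `p`

diameterBound : (p g n : ℕ) .{{_ : NonZero n}} (a r : ℤ) → ℤ
diameterBound p g n a r =
  + p ℤ.- ceiling (((+ p / 1) ℚ.+ ((+ g ℤ.* a ℤ.* (a ℤ.- 1ℤ)) / 2) ℚ.+ ((r ℤ.* a) / 1)) ℚ.* (1ℤ / n))

ruler-exists : ∀ p → Prime p → 5 ℕ.≤ p → ∀ n .{{_ : NonZero n}} → n ℕ.≤ (p ∸ 1) ℕ./ 2 →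
  ∀ a r → let g = (p ∸ 1) ℕ./ 4 in + n ≡ a ℤ.* + g ℤ.+ r → r ℤ.< + g →
  ∃[ m ] RulerWithin g n (+ m) × + m ℤ.≤ diameterBound p g n a r
ruler-exists p p-prime 5≤p n n≤ ℤ.-[1+ k ] r n≡ r<g =
  contradiction (quotient-nonNeg {ℤ.-[1+ k ]} n≡ r<g) λ ()
ruler-exists p p-prime 5≤p n n≤ (+ k) r n≡ r<g =
  span ,
  (ruler , ruler-isGolomb , length-ruler , diameter-least (ℤ.+≤+ z≤n) ruler-span) ,
  -- It suffices that the ceiling is at most `p - span`, which is `span-bound` at the height
  -- `k = a`.
  subst (ℤ._≤ diameterBound p g n (+ k) r) (identity (+ p) (+ span)) (ℤ.+-monoʳ-≤ (+ p) (ℤ.neg-mono-≤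
    (ceiling-average-≤ (+ p) (+ g ℤ.* + k ℤ.* (+ k ℤ.- 1ℤ)) (r ℤ.* + k) n (+ p ℤ.- + span)
      (weighted-sum-bound (+ p) (+ g) (+ span) (+ k) r n≡ (span-bound⇒ℤ p g n span k (span-bound k))))))
  where
  g = (p ∸ 1) ℕ./ 4
  instance
    p≢0 : NonZero p
    p≢0 = ℕ.>-nonZero (ℕ.≤-trans (s≤s z≤n) 5≤p)
  2<p : 2 ℕ.< p
  2<p = ℕ.≤-trans (s≤s (s≤s (s≤s z≤n))) 5≤p
  -- The first argument is `1 ≤ g`, obtained from `5 ≤ p` since `(5 ∸ 1) / 4` computes to 1.
  open ModularRuler {p} {g} {n} (ℕ./-monoˡ-≤ 4 (ℕ.∸-monoˡ-≤ 1 5≤p)) square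
    (square-mod-injective p-prime 2<p n≤) (square-differences p-prime 2<p n≤)
  identity : ∀ p m → p ℤ.- (p ℤ.- m) ≡ m
  identity = solve-∀

corollary11 :
    (p : ℕ) → Prime p → ¬ (2 ∣ p) → 5 ℕ.≤ p →
    (g : ℕ) → g ≡ (p ∸ 1) ℕ./ 4 →
    (n : ℕ) .{{_ : NonZero n}} → n ℕ.≤ (p ∸ 1) ℕ./ 2 →
    (a r : ℤ) → + n ≡ a ℤ.* + g ℤ.+ r → 0ℤ ℤ.≤ r → r ℤ.< + g →
    let
      numerator : ℚ
      numerator = (+ p / 1) ℚ.+ ((+ g ℤ.* a ℤ.* (a ℤ.- 1ℤ)) / 2) ℚ.+ ((r ℤ.* a) / 1)
      bound : ℤ
      bound = + p ℤ.- ceiling (numerator ℚ.* (1ℤ / n))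
    in
    (∃[ m ] IsMinDiameter g n m × m ℤ.≤ bound) ×
    ((g′ : ℕ) → g ℕ.≤ g′ → ∃[ m ] IsMinDiameter g′ n m × m ℤ.≤ bound)
corollary11 p p-prime _ 5≤p g refl n n≤ a r n≡ _ r<g = bounded g ℕ.≤-refl , bounded
  where
  bounded : ∀ g′ → g ℕ.≤ g′ → ∃[ m ] IsMinDiameter g′ n m × m ℤ.≤ diameterBound p g n a r
  bounded g′ g≤g′ =
    let m , (G , (!G , count≤g) , len , diam≤m) , m≤bound = ruler-exists p p-prime 5≤p n n≤ a r n≡ r<g
        -- The ruler found for `g` is also a ruler for `g′`, so it bounds the search for the minimum
        -- at `g′`.
        d , isMin , d≤m = minDiameter-≤ (G , (!G , λ e 0<e → ℕ.≤-trans (count≤g e 0<e) g≤g′) , len , diam≤m)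
    in d , isMin , ℤ.≤-trans d≤m m≤bound
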